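{- Consider two targets $t_1,t_2$ and biased direction-distance queries with constant probabilities $p_1>p_2=1-p_1>0$. Given $t_1$, the algorithm $\mathcal{D}$ (described in the context) detects $t_2$ in at most $O(\log^3 n)$ direction-distance queries with probability at least $1-O\left(\log n\cdot p_1^{\log n}\right)$, where $n$ is the number of vertices of the graph.
   Context: All logarithms are base $2$. Graphs $G=(V,E)$, $|V|=n$, are connected, simple, undirected, with positive edge weights $w$; $d$ is the shortest-path distance, and $N(v)$ is the set of neighbors of $v$. For $u\in N(v)$, $N(v,u)=\{x\in V: d(v,x)=w(vu)+d(u,x)\}$. There are two targets $t_1,t_2\in V$. A direction-distance query at $v$ independently returns, with probability $p_i$, a pair $(u,\ell)$ where $u\in N(v)$, $t_i\in N(v,u)$ and $\ell=d(v,t_i)$, without disclosing $i$; if several such $u$ exist, an arbitrary one (possibly chosen adversarially) is returned. If $v=t_i$, this is revealed by the query with probability $p_i$. Let $E_{t_1}(v)=\{u\in N(v):t_1\in N(v,u)\}$. For $S\subseteq V$ and $v\in V$, $\Gamma_S(v)=\max\{|N(v,u)\cap S|:u\in N(v)\}$. For a fixed constant $0\le\varepsilon<1$, a $(1+\varepsilon)$-median of $S$ for $\Gamma$ is a vertex $x\in V$ with $\Gamma_S(x)\le(1+\varepsilon)\min_{v\in V}\Gamma_S(v)$. Algorithm $\mathcal{D}$ ($t_1$ is known). Set $S\leftarrow V$. While $|S|>1$: compute an (exact or $(1+\varepsilon)$-approximate) median $v$ of $S$ with respect to $\Gamma$ and the set $E_{t_1}(v)$; query vertex $v$ $\log n$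 times, and let $Q(v)$ be the set of different responses. If there is a pair $(u,\ell)\in Q(v)$ with $u\notin E_{t_1}(v)$ or $\ell\ne d(v,t_1)$, set $S\leftarrow S\cap N(v,u)$. Otherwise, for every $(u,\ell)\in Q(v)$: query vertex $u$ $\log n$ times, and let $Q(u)$ be the set of different responses; if every $(z,\ell')\in Q(u)$ satisfies $\ell'=\ell-w(vu)$, then set $S\leftarrow S\cap N(v,u)$ and go to the next iteration of the while loop. When $|S|=1$, return the unique vertex of $S$. If a query reveals that the queried vertex is $t_2$, then $t_2$ is detected. The constants in $O(\cdot)$ may depend on $p_1$ and $\varepsilon$.
   Formalization: The description of D leaves open the order in which the pairs of Q(v) are examined, and for some orders the error can be of order log² n · p₁^(log n); here the pairs are examined in the order in which they were received (log n is rounded up to an integer). -}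

module Defs where

open import Level using (Level; 0ℓ; suc; _⊔_)
open import Algebra.Bundles using (CommutativeRing; Semiring)
import Algebra.Definitions.RawSemiring as RawSemiringDefs
open import Data.Bool.Base using (Bool; true; false; _∨_; if_then_else_)
open import Data.Fin.Base using (Fin)
import Data.Fin.Properties as Fin
open import Data.Fin.Subset using (Subset; _∈_; _∩_; ⊤; ∣_∣)
open import Data.Fin.Subset.Properties using (_∈?_)
open import Data.List.Base using (List; []; _∷_; map; filter; find; deduplicate; allFin)
open import Data.List.Extrema.Nat using (min; max)
open import Data.List.Relation.Unary.All using (all?)
open import Data.Maybe.Base using (Maybe; just; nothing; maybe)
open import Data.Nat.Base as ℕ using (ℕ)
open import Data.Nat.Logarithm using (⌈log₂_⌉)
import Data.Nat.Properties as ℕ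
open import Data.Product.Base using (_×_; _,_; ∃)
open import Data.Product.Relation.Binary.Pointwise.NonDependent using (×-decidable)
open import Data.Vec.Base as Vec using (Vec; []; _∷_; tabulate)
open import Relation.Binary.Construct.Closure.ReflexiveTransitive using (Star; _◅_) renaming (ε to done)
import Relation.Binary.Construct.StrictToNonStrict as StrictToNonStrict
open import Relation.Binary.Core using (Rel)
open import Relation.Binary.Definitions using (Decidable; Irreflexive; Symmetric)
open import Relation.Binary.PropositionalEquality.Core using (_≡_)
open import Relation.Binary.Structures using (IsStrictTotalOrder)
open import Relation.Nullary.Decidable.Core using (does; yes; no; ¬?; _×-dec_; _⊎-dec_)
open import Relation.Nullary.Negation.Core using (¬_)

private variable
  a b : Level
  A B : Set a

-- Edge weights, distances, ε and probabilities are real numbers in the source.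
-- Classically, the Archimedean ordered fields are the subfields of ℝ, ℝ itself
-- included. Trichotomy is what lets the algorithm compare distances.
record ArchimedeanOrderedField c ℓ₁ ℓ₂ : Set (suc (c ⊔ ℓ₁ ⊔ ℓ₂)) where
  field
    commutativeRing : CommutativeRing c ℓ₁
  open CommutativeRing commutativeRing public
  infix 4 _<_
  field
    _<_                : Rel Carrier ℓ₂
    isStrictTotalOrder : IsStrictTotalOrder _≈_ _<_
  open Semiring semiring public using (rawSemiring)
  open RawSemiringDefs rawSemiring public using (_^_) renaming (_×_ to _·_)
  field
    0<1         : 0# < 1#
    +-monoˡ-<   : ∀ {x y} z → x < y → x + z < y + z
    *-pos       : ∀ {x y} → 0# < x → 0# < y → 0# < x * y
    inverse     : ∀ {x} → ¬ (x ≈ 0#) → ∃ λ y → x * y ≈ 1#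
    archimedean : ∀ x → ∃ λ k → x < k · 1#

  open IsStrictTotalOrder isStrictTotalOrder public using (compare; _≟_; _<?_)
  open StrictToNonStrict _≈_ _<_ public using (_≤_)

  fromℕ : ℕ → Carrier
  fromℕ k = k · 1#

module Search {c ℓ₁ ℓ₂} (K : ArchimedeanOrderedField c ℓ₁ ℓ₂) where
  open ArchimedeanOrderedField K

  record WeightedGraph (n : ℕ) : Set (suc 0ℓ ⊔ c ⊔ ℓ₁ ⊔ ℓ₂) where
    field
      Adj       : Rel (Fin n) 0ℓ
      adj?      : Decidable Adj
      irrefl    : Irreflexive _≡_ Adj
      symmetric : Symmetric Adj
      connected : ∀ u v → Star Adj u v
      -- Only the values of w on adjacent pairs matter.
      w         : Fin n → Fin n → Carrier
      w-sym     : ∀ {u v} → Adj u v → w u v ≈ w v u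
      w-pos     : ∀ {u v} → Adj u v → 0# < w u v

    length : ∀ {u v} → Star Adj u v → Carrier
    length done                      = 0#
    length (_◅_ {i = u} {j = v} e p) = w u v + length p

    neighbours : Fin n → List (Fin n)
    neighbours v = filter (adj? v) (allFin n)

  record ShortestPathDistance {n} (G : WeightedGraph n) : Set (c ⊔ ℓ₁ ⊔ ℓ₂) where
    open WeightedGraph G
    field
      d        : Fin n → Fin n → Carrier
      shortest : ∀ {u v} (p : Star Adj u v) → d u v ≤ length p
      attained : ∀ u v → ∃ λ (p : Star Adj u v) → d u v ≈ length p

  data Target : Set where
    first second : Target

  Pr : (p₁ p₂ : Carrier) (k : ℕ) → (Vec Target k → Bool) → Carrier
  Pr p₁ p₂ ℕ.zero    E = if E [] then 1# else 0#
  Pr p₁ p₂ (ℕ.suc k) E = p₁ * Pr p₁ p₂ k (λ ω → E (first ∷ ω))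
                       + p₂ * Pr p₁ p₂ k (λ ω → E (second ∷ ω))

  module _ {n} (G : WeightedGraph n) (D : ShortestPathDistance G) where
    open WeightedGraph G
    open ShortestPathDistance D

    N : Fin n → Fin n → Subset n
    N v u = tabulate λ x → does (d v x ≟ w v u + d u x)

    Γ : Subset n → Fin n → ℕ
    Γ S v = max 0 (map (λ u → ∣ N v u ∩ S ∣) (neighbours v))

    -- Γ S v ≤ n for every v, so the default value n does not affect the minimum.
    IsMedian : Carrier → Subset n → Fin n → Set (ℓ₁ ⊔ ℓ₂)
    IsMedian ε S x = fromℕ (Γ S x) ≤ (1# + ε) * fromℕ (min n (map (Γ S) (allFin n)))

    E : Fin n → Fin n → Subset n
    E t v = tabulate λ u → does (adj? v u ×-dec t ∈? N v u)

    -- The index carried by `found` gives an algorithm that knows t first no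
    -- information unless the two targets coincide.
    data Answer : Set c where
      found  : Target → Answer
      toward : Fin n → Carrier → Answer

    -- Legitimate answers to a query at v that is served for target i.
    data Truthful (t : Target → Fin n) (i : Target) (v : Fin n) : Answer → Set (c ⊔ ℓ₁) where
      found  : v ≡ t i → Truthful t i v (found i)
      toward : ∀ {u ℓ} → Adj v u → t i ∈ N v u → ℓ ≈ d v (t i) →
               Truthful t i v (toward u ℓ)

    -- Most recent query first.
    History : Set c
    History = List (Fin n × Target × Answer)

    -- An adaptive adversary: it sees everything that happened so far,
    -- including which target each earlier query was served for.
    record Oracle (t : Target → Fin n) : Set (c ⊔ ℓ₁) where
      field
        answer   : History → Fin n → Target → Answer
        truthful : ∀ h v i → Truthful t i v (answer h v i)

    data Program (A : Set a) : Set (a ⊔ c) where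
      return : A → Program A
      query  : Fin n → (Answer → Program A) → Program A

    infixl 1 _>>=_
    _>>=_ : Program A → (A → Program B) → Program B
    return x  >>= f = f x
    query v k >>= f = query v λ r → k r >>= f

    Pair : Set c
    Pair = Fin n × Carrier

    responses : ℕ → Fin n → Program (List Pair)
    responses ℕ.zero    v = return []
    responses (ℕ.suc k) v = query v λ r → responses k v >>= λ q → return (add r q)
      where
      add : Answer → List Pair → List Pair
      add (found _)    q = q
      add (toward u ℓ) q = (u , ℓ) ∷ q

    -- The number log n of repetitions is rounded up. With p₁ ^ log n rounded the
    -- same way, it changes by at most a factor 1/p₁.
    --
    -- `deduplicate` keeps first occurrences, so the pairs are later examined in
    -- the order in which they were received. The order matters: if wrong pairs
    -- could be moved in front of those received for t second, an adversary
    -- could force up to ⌈log₂ n⌉ of them to be tested in each iteration.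
    Q : Fin n → Program (List Pair)
    Q v = responses ⌈log₂ n ⌉ v >>= λ q →
          return (deduplicate (×-decidable Fin._≟_ _≟_) q)

    module Algorithm (t₁ : Fin n) (median : Subset n → Fin n) where

      test : Fin n → Pair → Program Bool
      test v (u , ℓ) = Q u >>= λ q → return (does (all? (λ (_ , ℓ′) → ℓ′ ≟ ℓ - w v u) q))

      testEach : Subset n → Fin n → List Pair → Program (Subset n)
      testEach S v []            = return S
      testEach S v ((u , ℓ) ∷ q) = test v (u , ℓ) >>= λ passed →
        if passed then return (S ∩ N v u) else testEach S v q

      iteration : Subset n → Program (Subset n)
      iteration S = Q v >>= λ q → maybe
          (λ (u , _) → return (S ∩ N v u))
          (testEach S v q)
          (find (λ (u , ℓ) → ¬? (u ∈? E t₁ v) ⊎-dec ¬? (ℓ ≟ d v t₁)) q)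
        where
        v : Fin n
        v = median S

      unique : List (Fin n) → Maybe (Fin n)
      unique (x ∷ []) = just x
      unique _        = nothing

      -- At most k iterations of the while loop from S.
      while : ℕ → Subset n → Program (Maybe (Fin n))
      while k S with ∣ S ∣ ℕ.≤? 1 | k
      ... | yes _ | _        = return (unique (filter (_∈? S) (allFin n)))
      ... | no  _ | ℕ.zero   = return nothing
      ... | no  _ | ℕ.suc k′ = iteration S >>= while k′

    module _ {t : Target → Fin n} (O : Oracle t) where
      open Oracle O

      reveals : Answer → Bool
      reveals (found second) = true
      reveals _              = false

      returns : Maybe (Fin n) → Bool
      returns (just x) = does (x Fin.≟ t second)
      returns nothing  = false

      -- Does the program detect t second, by a query or by its result, before
      -- it asks more than k queries, when the i-th query is served for the
      -- i-th entry of ω?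
      detects : ∀ {k} → Program (Maybe (Fin n)) → History → Vec Target k → Bool
      detects (return r)  h ω       = returns r
      detects (query v f) h []      = false
      detects (query v f) h (i ∷ ω) =
        reveals r ∨ detects (f r) ((v , i , r) ∷ h) ω
        where r = answer h v i

      -- An iteration is only started when 1 < ∣ S ∣ ≤ n, and then asks at least
      -- ⌈log₂ n ⌉ ≥ 1 queries, so k queries never outlast k iterations.
      𝒟-detects : (Subset n → Fin n) → ∀ {k} → Vec Target k → Bool
      𝒟-detects median {k} = detects (while k ⊤) []
        where open Algorithm (t first) median

{-# OPTIONS --safe #-}
module Submission where

-- Why the theorem holds. Write L for the rounded-up logarithm of n, and π for
-- p₁ ^ L, the probability that L queries are all served for the known target.
--
-- Progress. A vertex v that minimises the sum of the distances to S has at most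
-- half of S in each N(v,u): if more than half were there, moving from v to u
-- would decrease the sum (`centroid`). Hence a (1+ε)-median v satisfies
-- |S ∩ N(v,u)| ≤ ρ |S| for every neighbour u, where ρ = (1+ε)/2 < 1
-- (`median-shrinks`), and O(L) iterations that replace S by such a set S ∩ N(v,u)
-- leave at most one vertex in S (`∃-halving`, `a^k*2^k≤1`).
--
-- Correctness of one iteration. Unless v is the second target, which a query
-- served for that target would reveal, some response at v is served for the
-- second target, except with probability π. A pair that is inconsistent
-- with the first target was served for the second, so it points towards it.
-- Otherwise both targets are at the same distance from v, because a pair served
-- for the second target reports the distance of the first. In that case a pair
-- (u , ℓ) with the second target in N(v,u) always passes its test
-- (`test-passes`), while any other pair passes only if no query at u is served
-- for the second target, again with probability π (`test-fails`).
--
-- Failure probability. The pairs are tested in order of arrival, and testing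
-- stops at the latest at the first one served for the second target. Each pair
-- tested before it costs at most π, and the number of those is dominated by a
-- geometric variable of mean r = p₁/p₂. So an iteration fails with probability
-- at most π + r π (`responses-hit`, `iteration-outcome`) and asks at most L + L²
-- queries.
-- Summing over the O(L) iterations gives the theorem (`while-locates`).
--
-- The oracle is adaptive, so conditional probabilities are awkward. Instead, the
-- judgement `Bound` propagates an upper bound on the probability of failure
-- through a program, one query at a time and against every truthful answer;
-- `sound` turns it into the bound on `Pr`.

open import Defs
open import Level using (Level; _⊔_)
import Algebra.Properties.CommutativeSemiring.Exp as CommutativeExp
import Algebra.Properties.Semiring.Exp as Exp
import Algebra.Properties.Semiring.Mult as Mult
import Algebra.Solver.Ring.NaturalCoefficients.Default as SemiringSolver
open import Data.Bool.Base using (Bool; true; false)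
open import Data.Fin.Base using (Fin; zero; suc)
import Data.Fin.Properties as Fin
open import Data.Fin.Subset using (Subset; inside; outside; _∈_; _∉_; _∩_; ∣_∣)
open import Data.Fin.Subset.Properties
  using (_∈?_; ∈⊤; ∣⊤∣≡n; ∩-comm; x∈p∩q⁺; x∈p∧x≢y⇒x∈p-y; x∈p⇒∣p-x∣<∣p∣)
open import Data.List.Base as List using (List; []; _∷_; filter; deduplicate; find; allFin)
open import Data.List.Extrema.Nat using (min; min≤v⁺; max≤v⁺; xs≤max)
open import Data.List.Membership.Propositional using () renaming (_∈_ to _∈ᴸ_)
open import Data.List.Membership.Propositional.Properties
  using (∈-allFin; ∈-filter⁺; ∈-filter⁻; ∈-map⁺)
import Data.List.Properties as List
open import Data.List.Relation.Unary.All as All using (All; []; _∷_; all?)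
import Data.List.Relation.Unary.All.Properties as All
open import Data.List.Relation.Unary.AllPairs using (_∷_)
open import Data.List.Relation.Unary.Any as Any using (Any; here; there)
open import Data.List.Relation.Unary.Unique.Propositional using (Unique)
open import Data.List.Relation.Unary.Unique.Propositional.Properties using (allFin⁺; filter⁺)
open import Data.Maybe.Base using (Maybe; just; nothing; maybe)
open import Data.Nat.Base as ℕ using (ℕ)
open import Data.Nat.DivMod using (m/n*n≤m; m*n/n≡m; /-monoˡ-≤)
open import Data.Nat.Logarithm using (⌈log₂_⌉; ⌈log₂⌉-mono-≤; ⌈log₂⌈n/2⌉⌉≡⌈log₂n⌉∸1)
import Data.Nat.Properties as ℕ
open import Data.Nat.Solver using (module +-*-Solver)
open import Data.Product.Base using (Σ-syntax; _×_; _,_; ∃; proj₁; proj₂)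
open import Data.Product.Relation.Binary.Pointwise.NonDependent using (×-decidable)
open import Data.Sum.Base using (_⊎_; inj₁; inj₂)
open import Data.Vec.Base using (Vec; []; _∷_; here; there)
open import Data.Vec.Properties using (lookup∘tabulate; lookup⇒[]=; []=⇒lookup)
open import Function.Base using (_∘_)
open import Relation.Binary.Bundles using (StrictPartialOrder)
open import Relation.Binary.Construct.Closure.ReflexiveTransitive using (_◅_)
import Relation.Binary.Construct.StrictToNonStrict as StrictToNonStrict
open import Relation.Binary.Core using (Rel)
import Relation.Binary.Definitions as Binary
open import Relation.Binary.Definitions using (tri<; tri≈; tri>)
open import Relation.Binary.PropositionalEquality.Core as ≡ using (_≡_)
import Relation.Binary.Reasoning.StrictPartialOrder as StrictPartialOrderReasoning
open import Relation.Binary.Structures using (IsStrictTotalOrder)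
open import Relation.Nullary.Decidable
  using (Dec; does; yes; no; dec-true; dec-false; ¬?; _×-dec_; _⊎-dec_; decidable-stable)
open import Relation.Nullary.Negation.Core using (¬_; contradiction)
open import Relation.Unary using (Pred; Decidable)

private variable
  a b ℓ ℓ′ : Level
  A : Set a
  B : Set b

-- Lists, subsets and binary logarithms

does⁻ : ∀ {a} {A : Set a} (a? : Dec A) → does a? ≡ true → A
does⁻ (yes a) _ = a

-- Dependent elimination of the result of `find`.
find-elim : {P : Pred A ℓ} (P? : Decidable P) (T : Maybe A → Set ℓ′) → ∀ xs →
            (∀ {x} → x ∈ᴸ xs → P x → T (just x)) →
            (All (¬_ ∘ P) xs → T nothing) → T (find P? xs)
find-elim P? T []       _   none = none []
find-elim P? T (x ∷ xs) one none with P? x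
... | yes px = one (here ≡.refl) px
... | no ¬px = find-elim P? T xs (one ∘ there) (none ∘ (¬px ∷_))

deduplicate⁺ : {R : Rel A ℓ} (R? : Binary.Decidable R) {P : Pred A ℓ′} → ∀ {xs} →
               All P xs → All P (deduplicate R? xs)
deduplicate⁺ R? []         = []
deduplicate⁺ R? (px ∷ pxs) = px ∷ All.filter⁺ (¬? ∘ R? _) (deduplicate⁺ R? pxs)

singleton-filter : ∀ {n} {S : Subset n} {x} → x ∈ S → ∣ S ∣ ℕ.≤ 1 →
                   filter (_∈? S) (allFin n) ≡ x ∷ []
singleton-filter {n} {S} {x} x∈S ∣S∣≤1 =
  lemma _ (filter⁺ (_∈? S) (allFin⁺ n)) (∈-filter⁺ (_∈? S) (∈-allFin x) x∈S)
    (λ y∈ → ≡x (proj₂ (∈-filter⁻ (_∈? S) {xs = allFin n} y∈)))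
  where
  ≡x : ∀ {y} → y ∈ S → y ≡ x
  ≡x {y} y∈S = decidable-stable (y Fin.≟ x) λ y≢x →
    ℕ.<⇒≱ (ℕ.≤-<-trans ℕ.z≤n (x∈p⇒∣p-x∣<∣p∣ (x∈p∧x≢y⇒x∈p-y y∈S y≢x)))
      (ℕ.≤-pred (ℕ.≤-trans (x∈p⇒∣p-x∣<∣p∣ x∈S) ∣S∣≤1))
  lemma : ∀ xs → Unique xs → x ∈ᴸ xs → (∀ {y} → y ∈ᴸ xs → y ≡ x) → xs ≡ x ∷ []
  lemma (y ∷ [])     _ _ all≡x = ≡.cong (_∷ []) (all≡x (here ≡.refl))
  lemma (y ∷ z ∷ zs) ((y≢z ∷ _) ∷ _) _ all≡x = contradiction
    (≡.trans (all≡x (here ≡.refl)) (≡.sym (all≡x (there (here ≡.refl))))) y≢z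

n≤2^⌈log₂n⌉ : ∀ n → n ℕ.≤ 2 ℕ.^ ⌈log₂ n ⌉
n≤2^⌈log₂n⌉ n = bound n ℕ.≤-refl
  where
  open ℕ.≤-Reasoning
  bound : ∀ n {k} → ⌈log₂ n ⌉ ℕ.≤ k → n ℕ.≤ 2 ℕ.^ k
  bound 0 _ = ℕ.z≤n
  bound 1 {k} _ = ℕ.m^n>0 2 k
  bound (ℕ.suc (ℕ.suc n)) {ℕ.zero} log≤0 = contradiction
    (ℕ.≤-trans (⌈log₂⌉-mono-≤ (ℕ.s≤s (ℕ.s≤s (ℕ.z≤n {n})))) log≤0) λ ()
  bound m@(ℕ.suc (ℕ.suc _)) {ℕ.suc k} log≤1+k = begin
    m                                   ≡⟨ ℕ.⌊n/2⌋+⌈n/2⌉≡n m ⟨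
    ℕ.⌊ m /2⌋ ℕ.+ ℕ.⌈ m /2⌉             ≤⟨ ℕ.+-monoˡ-≤ _ (ℕ.⌊n/2⌋≤⌈n/2⌉ m) ⟩
    ℕ.⌈ m /2⌉ ℕ.+ ℕ.⌈ m /2⌉             ≤⟨ ℕ.+-mono-≤ half half ⟩
    2 ℕ.^ k ℕ.+ 2 ℕ.^ k                 ≡⟨ ≡.cong (2 ℕ.^ k ℕ.+_) (ℕ.+-identityʳ _) ⟨
    2 ℕ.^ ℕ.suc k                       ∎
    where
    half : ℕ.⌈ m /2⌉ ℕ.≤ 2 ℕ.^ k
    half = bound ℕ.⌈ m /2⌉ (begin
      ⌈log₂ ℕ.⌈ m /2⌉ ⌉ ≡⟨ ⌈log₂⌈n/2⌉⌉≡⌈log₂n⌉∸1 m ⟩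
      ⌈log₂ m ⌉ ℕ.∸ 1   ≤⟨ ℕ.∸-monoˡ-≤ 1 log≤1+k ⟩
      k                 ∎)

-- Everything below is relative to an Archimedean ordered field.
module Proof {c ℓ₁ ℓ₂} (K : ArchimedeanOrderedField c ℓ₁ ℓ₂) where
  open ArchimedeanOrderedField K hiding (zero)
  open Search K

  -- Arithmetic in ordered fields

  open IsStrictTotalOrder isStrictTotalOrder public
    using (isStrictPartialOrder; irrefl; <-respˡ-≈; <-respʳ-≈)
    renaming (trans to <-trans; asym to <-asym)
  open Mult semiring public using (×-homo-+; ×1-homo-*; ×-assoc-*; ×-congʳ)
  open Exp semiring public using (^-congˡ; ^-assocʳ)
  open CommutativeExp commutativeSemiring using (^-distrib-*)

  strictPartialOrder : StrictPartialOrder c ℓ₁ ℓ₂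
  strictPartialOrder = record { isStrictPartialOrder = isStrictPartialOrder }

  module ≤-Reasoning = StrictPartialOrderReasoning strictPartialOrder
  open SemiringSolver commutativeSemiring using (solve; _:=_; _:+_; _:*_; con)

  ≤-refl : ∀ {x} → x ≤ x
  ≤-refl = inj₂ refl

  ≤-trans : ∀ {x y z} → x ≤ y → y ≤ z → x ≤ z
  ≤-trans = StrictToNonStrict.trans _≈_ _<_ isEquivalence (<-respʳ-≈ , <-respˡ-≈) <-trans

  <⇒≱ : ∀ {x y} → x < y → ¬ (y ≤ x)
  <⇒≱ x<y (inj₁ y<x) = <-asym x<y y<x
  <⇒≱ x<y (inj₂ y≈x) = irrefl (sym y≈x) x<y

  +-monoˡ-≤ : ∀ {x y} z → x ≤ y → x + z ≤ y + z
  +-monoˡ-≤ z (inj₁ x<y) = inj₁ (+-monoˡ-< z x<y)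
  +-monoˡ-≤ z (inj₂ x≈y) = inj₂ (+-congʳ x≈y)

  +-monoʳ-≤ : ∀ {x y} z → x ≤ y → z + x ≤ z + y
  +-monoʳ-≤ {x} {y} z x≤y = begin
    z + x ≈⟨ +-comm z x ⟩
    x + z ≤⟨ +-monoˡ-≤ z x≤y ⟩
    y + z ≈⟨ +-comm y z ⟩
    z + y ∎
    where open ≤-Reasoning

  +-mono-≤ : ∀ {x y u v} → x ≤ y → u ≤ v → x + u ≤ y + v
  +-mono-≤ {y = y} {u = u} x≤y u≤v = ≤-trans (+-monoˡ-≤ u x≤y) (+-monoʳ-≤ y u≤v)

  +-cancelʳ-≤ : ∀ {x y} z → x + z ≤ y + z → x ≤ y
  +-cancelʳ-≤ {x} {y} z x+z≤y+z = begin
    x               ≈⟨ lemma x ⟩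
    x + z + (- z)   ≤⟨ +-monoˡ-≤ (- z) x+z≤y+z ⟩
    y + z + (- z)   ≈⟨ lemma y ⟨
    y               ∎
    where
    open ≤-Reasoning
    lemma : ∀ a → a ≈ a + z + (- z)
    lemma a = sym (trans (+-assoc a z (- z)) (trans (+-congˡ (-‿inverseʳ z)) (+-identityʳ a)))

  x≤x+y : ∀ x {y} → 0# ≤ y → x ≤ x + y
  x≤x+y x {y} 0≤y = begin
    x      ≈⟨ +-identityʳ x ⟨
    x + 0# ≤⟨ +-monoʳ-≤ x 0≤y ⟩
    x + y  ∎
    where open ≤-Reasoning

  0≤x+y : ∀ {x y} → 0# ≤ x → 0# ≤ y → 0# ≤ x + y
  0≤x+y {x} 0≤x 0≤y = ≤-trans 0≤x (x≤x+y x 0≤y)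

  x<y⇒0<y-x : ∀ {x y} → x < y → 0# < y - x
  x<y⇒0<y-x {x} {y} x<y = begin-strict
    0#    ≈⟨ -‿inverseʳ x ⟨
    x - x <⟨ +-monoˡ-< (- x) x<y ⟩
    y - x ∎
    where open ≤-Reasoning

  y-x+x≈y : ∀ y x → (y - x) + x ≈ y
  y-x+x≈y y x = trans (+-assoc y (- x) x) (trans (+-congˡ (-‿inverseˡ x)) (+-identityʳ y))

  *-monoˡ-< : ∀ {x y} z → 0# < z → x < y → z * x < z * y
  *-monoˡ-< {x} {y} z 0<z x<y = begin-strict
    z * x               ≈⟨ +-identityˡ (z * x) ⟨
    0# + z * x          <⟨ +-monoˡ-< (z * x) (*-pos 0<z (x<y⇒0<y-x x<y)) ⟩
    z * (y - x) + z * x ≈⟨ distribˡ z (y - x) x ⟨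
    z * ((y - x) + x)   ≈⟨ *-congˡ (y-x+x≈y y x) ⟩
    z * y               ∎
    where open ≤-Reasoning

  *-monoˡ-≤ : ∀ {x y z} → 0# ≤ z → x ≤ y → z * x ≤ z * y
  *-monoˡ-≤ _          (inj₂ x≈y) = inj₂ (*-congˡ x≈y)
  *-monoˡ-≤ (inj₁ 0<z) (inj₁ x<y) = inj₁ (*-monoˡ-< _ 0<z x<y)
  *-monoˡ-≤ {x} {y} {z} (inj₂ 0≈z) (inj₁ _) = inj₂ (begin-equality
    z * x  ≈⟨ *-congʳ 0≈z ⟨
    0# * x ≈⟨ zeroˡ x ⟩
    0#     ≈⟨ zeroˡ y ⟨
    0# * y ≈⟨ *-congʳ 0≈z ⟩
    z * y  ∎)
    where open ≤-Reasoning

  *-monoʳ-≤ : ∀ {x y z} → 0# ≤ z → x ≤ y → x * z ≤ y * z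
  *-monoʳ-≤ {x} {y} {z} 0≤z x≤y = begin
    x * z ≈⟨ *-comm x z ⟩
    z * x ≤⟨ *-monoˡ-≤ 0≤z x≤y ⟩
    z * y ≈⟨ *-comm z y ⟩
    y * z ∎
    where open ≤-Reasoning

  0≤x*y : ∀ {x y} → 0# ≤ x → 0# ≤ y → 0# ≤ x * y
  0≤x*y {x} {y} 0≤x 0≤y = begin
    0#     ≈⟨ zeroʳ x ⟨
    x * 0# ≤⟨ *-monoˡ-≤ 0≤x 0≤y ⟩
    x * y  ∎
    where open ≤-Reasoning

  0≤x^k : ∀ {x} k → 0# ≤ x → 0# ≤ x ^ k
  0≤x^k ℕ.zero    0≤x = inj₁ 0<1
  0≤x^k (ℕ.suc k) 0≤x = 0≤x*y 0≤x (0≤x^k k 0≤x)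

  0≤k·x : ∀ {x} k → 0# ≤ x → 0# ≤ k · x
  0≤k·x ℕ.zero    0≤x = ≤-refl
  0≤k·x (ℕ.suc k) 0≤x = 0≤x+y 0≤x (0≤k·x k 0≤x)

  ·-monoˡ-≤ : ∀ {m n x} → 0# ≤ x → m ℕ.≤ n → m · x ≤ n · x
  ·-monoˡ-≤ {n = n} 0≤x ℕ.z≤n       = 0≤k·x n 0≤x
  ·-monoˡ-≤ {x = x} 0≤x (ℕ.s≤s m≤n) = +-monoʳ-≤ x (·-monoˡ-≤ 0≤x m≤n)

  x<suc[k]·x : ∀ {x} k → 0# < x → k · x < ℕ.suc k · x
  x<suc[k]·x {x} k 0<x = begin-strict
    k · x      ≈⟨ +-identityˡ _ ⟨
    0# + k · x <⟨ +-monoˡ-< (k · x) 0<x ⟩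
    x + k · x  ∎
    where open ≤-Reasoning

  ·-cancelˡ-≤ : ∀ {m n x} → 0# < x → m · x ≤ n · x → m ℕ.≤ n
  ·-cancelˡ-≤ {m} {n} 0<x mx≤nx with m ℕ.≤? n
  ... | yes m≤n = m≤n
  ... | no  m≰n = contradiction
    (≤-trans (·-monoˡ-≤ (inj₁ 0<x) (ℕ.≰⇒> m≰n)) mx≤nx)
    (<⇒≱ (x<suc[k]·x n 0<x))

  fromℕ-mono-≤ : ∀ {m n} → m ℕ.≤ n → fromℕ m ≤ fromℕ n
  fromℕ-mono-≤ = ·-monoˡ-≤ (inj₁ 0<1)

  0≤fromℕ : ∀ n → 0# ≤ fromℕ n
  0≤fromℕ n = 0≤k·x n (inj₁ 0<1)

  0<2 : 0# < 1# + 1#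
  0<2 = <-trans 0<1 (begin-strict
    1#      ≈⟨ +-identityˡ 1# ⟨
    0# + 1# <⟨ +-monoˡ-< 1# 0<1 ⟩
    1# + 1# ∎)
    where open ≤-Reasoning

  0<x⇒x≉0 : ∀ {x} → 0# < x → ¬ (x ≈ 0#)
  0<x⇒x≉0 0<x x≈0 = irrefl (sym x≈0) 0<x

  0<inverse : ∀ {x y} → 0# < x → x * y ≈ 1# → 0# < y
  0<inverse {x} {y} 0<x xy≈1 with compare 0# y
  ... | tri< 0<y _ _ = 0<y
  ... | tri≈ _ 0≈y _ = contradiction
    (trans (sym xy≈1) (trans (*-congˡ (sym 0≈y)) (zeroʳ x))) (0<x⇒x≉0 0<1)
  ... | tri> _ _ y<0 = contradiction (begin-strict
    1#     ≈⟨ xy≈1 ⟨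
    x * y  <⟨ *-monoˡ-< x 0<x y<0 ⟩
    x * 0# ≈⟨ zeroʳ x ⟩
    0#     ∎) (<-asym 0<1)
    where open ≤-Reasoning

  -- Bernoulli's inequality.
  1+k·x≤[1+x]^k : ∀ {x} k → 0# ≤ x → 1# + k · x ≤ (1# + x) ^ k
  1+k·x≤[1+x]^k ℕ.zero _ = inj₂ (+-identityʳ 1#)
  1+k·x≤[1+x]^k {x} (ℕ.suc k) 0≤x = begin
    1# + (x + k · x)                    ≤⟨ x≤x+y _ (0≤x*y 0≤x (0≤k·x k 0≤x)) ⟩
    1# + (x + k · x) + x * (k · x)
      ≈⟨ solve 2 (λ x y → con 1 :+ (x :+ y) :+ x :* y
           := (con 1 :+ x) :* (con 1 :+ y)) refl x (k · x) ⟩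
    (1# + x) * (1# + k · x)             ≤⟨ *-monoˡ-≤ (0≤x+y (inj₁ 0<1) 0≤x) (1+k·x≤[1+x]^k k 0≤x) ⟩
    (1# + x) * (1# + x) ^ k             ∎
    where open ≤-Reasoning

  ∃-doubling : ∀ {σ} → 1# < σ → ∃ λ k → 1# + 1# ≤ σ ^ k
  ∃-doubling {σ} 1<σ =
    let y , xy≈1 = inverse (0<x⇒x≉0 0<x)
        k , y<k  = archimedean y
    in k , (begin
      1# + 1#              ≈⟨ +-congˡ xy≈1 ⟨
      1# + x * y           ≤⟨ +-monoʳ-≤ 1# (*-monoˡ-≤ (inj₁ 0<x) (inj₁ y<k)) ⟩
      1# + x * fromℕ k     ≈⟨ +-congˡ (*-comm x (fromℕ k)) ⟩
      1# + fromℕ k * x     ≈⟨ +-congˡ (×-assoc-* k 1# x) ⟩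
      1# + k · (1# * x)    ≈⟨ +-congˡ (×-congʳ k (*-identityˡ x)) ⟩
      1# + k · x           ≤⟨ 1+k·x≤[1+x]^k k (inj₁ 0<x) ⟩
      (1# + x) ^ k         ≈⟨ ^-congˡ k (trans (+-comm 1# x) (y-x+x≈y σ 1#)) ⟩
      σ ^ k                ∎)
    where
    open ≤-Reasoning
    x : Carrier
    x = σ - 1#
    0<x : 0# < x
    0<x = x<y⇒0<y-x 1<σ

  -- Some power of a positive number below 1 is at most one half.
  ∃-halving : ∀ {ρ} → 0# < ρ → ρ < 1# → ∃ λ k → ρ ^ k + ρ ^ k ≤ 1#
  ∃-halving {ρ} 0<ρ ρ<1 =
    let σ , ρσ≈1 = inverse (0<x⇒x≉0 0<ρ)
        k , 2≤σᵏ = ∃-doubling (1<σ (0<inverse 0<ρ ρσ≈1) ρσ≈1)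
    in k , (begin
      ρ ^ k + ρ ^ k        ≈⟨ solve 1 (λ r → r :+ r := r :* (con 1 :+ con 1)) refl (ρ ^ k) ⟩
      ρ ^ k * (1# + 1#)    ≤⟨ *-monoˡ-≤ (0≤x^k k (inj₁ 0<ρ)) 2≤σᵏ ⟩
      ρ ^ k * σ ^ k        ≈⟨ ^-distrib-* ρ σ k ⟨
      (ρ * σ) ^ k          ≈⟨ ^-congˡ k ρσ≈1 ⟩
      1# ^ k               ≈⟨ 1^k≈1 k ⟩
      1#                   ∎)
    where
    open ≤-Reasoning
    1<σ : ∀ {σ} → 0# < σ → ρ * σ ≈ 1# → 1# < σ
    1<σ {σ} 0<σ ρσ≈1 = begin-strict
      1#     ≈⟨ ρσ≈1 ⟨
      ρ * σ  ≈⟨ *-comm ρ σ ⟩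
      σ * ρ  <⟨ *-monoˡ-< σ 0<σ ρ<1 ⟩
      σ * 1# ≈⟨ *-identityʳ σ ⟩
      σ      ∎
    1^k≈1 : ∀ k → 1# ^ k ≈ 1#
    1^k≈1 ℕ.zero    = refl
    1^k≈1 (ℕ.suc k) = trans (*-identityˡ _) (1^k≈1 k)

  a^k*2^k≤1 : ∀ {a} k → 0# ≤ a → a + a ≤ 1# → a ^ k * fromℕ (2 ℕ.^ k) ≤ 1#
  a^k*2^k≤1 ℕ.zero 0≤a 2a≤1 = inj₂ (trans (*-identityˡ _) (+-identityʳ 1#))
  a^k*2^k≤1 {a} (ℕ.suc k) 0≤a 2a≤1 = begin
    a * a ^ k * fromℕ (2ᵏ ℕ.+ (2ᵏ ℕ.+ 0))      ≈⟨ *-congˡ (×-homo-+ 1# 2ᵏ (2ᵏ ℕ.+ 0)) ⟩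
    a * a ^ k * (fromℕ 2ᵏ + fromℕ (2ᵏ ℕ.+ 0))  ≈⟨ *-congˡ (+-congˡ (×-homo-+ 1# 2ᵏ 0)) ⟩
    a * a ^ k * (fromℕ 2ᵏ + (fromℕ 2ᵏ + 0#))
      ≈⟨ solve 3 (λ a b t → a :* b :* (t :+ (t :+ con 0))
           := (a :+ a) :* (b :* t)) refl a (a ^ k) (fromℕ 2ᵏ) ⟩
    (a + a) * (a ^ k * fromℕ 2ᵏ)
      ≤⟨ *-monoʳ-≤ (0≤x*y (0≤x^k k 0≤a) (0≤fromℕ 2ᵏ)) 2a≤1 ⟩
    1# * (a ^ k * fromℕ 2ᵏ)                    ≈⟨ *-identityˡ _ ⟩
    a ^ k * fromℕ 2ᵏ                           ≤⟨ a^k*2^k≤1 k 0≤a 2a≤1 ⟩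
    1#                                         ∎
    where
    open ≤-Reasoning
    2ᵏ : ℕ
    2ᵏ = 2 ℕ.^ k

  -- Medians halve the search space

  -- The argument of type Fin n only says that n is positive.
  minimiser : ∀ {n} → Fin n → (f : Fin n → Carrier) → ∃ λ v → ∀ u → f v ≤ f u
  minimiser {ℕ.suc ℕ.zero} _ f = zero , λ { zero → ≤-refl }
  minimiser {ℕ.suc (ℕ.suc n)} _ f with minimiser zero (λ i → f (suc i))
  ... | v , fv≤ with compare (f zero) (f (suc v))
  ... | tri< f0<fv _ _ = zero , λ { zero → ≤-refl ; (suc u) → ≤-trans (inj₁ f0<fv) (fv≤ u) }
  ... | tri≈ _ f0≈fv _ = zero , λ { zero → ≤-refl ; (suc u) → ≤-trans (inj₂ f0≈fv) (fv≤ u) }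
  ... | tri> _ _ fv<f0 = suc v , λ { zero → inj₁ fv<f0 ; (suc u) → fv≤ u }

  -- The sum of f over the elements of a subset.
  ∑ : ∀ {n} → Subset n → (Fin n → Carrier) → Carrier
  ∑ []            f = 0#
  ∑ (inside  ∷ S) f = f zero + ∑ S (λ i → f (suc i))
  ∑ (outside ∷ S) f = ∑ S (λ i → f (suc i))

  -- With f and g the distances from v and from a neighbour u at distance w, and
  -- T = N(v,u): moving from v to u saves w for each element of S in T, and costs
  -- at most w for each of the others. The term for S on the right charges w for
  -- every element, so the saving is counted twice on the left.
  ∑-step : ∀ {n} (T S : Subset n) {f g : Fin n → Carrier} {w} →
           (∀ {i} → i ∈ T → f i ≈ w + g i) → (∀ i → g i ≤ w + f i) →
           ∑ S g + (∣ T ∩ S ∣ ℕ.* 2) · w ≤ ∑ S f + ∣ S ∣ · w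
  ∑-step [] [] _ _ = ≤-refl
  ∑-step (inside ∷ T) (outside ∷ S) near far = ∑-step T S (near ∘ there) (far ∘ suc)
  ∑-step (outside ∷ T) (outside ∷ S) near far = ∑-step T S (near ∘ there) (far ∘ suc)
  ∑-step (inside ∷ T) (inside ∷ S) {f} {g} {w} near far = begin
    (g zero + ∑ S g′) + (w + (w + k · w))
      ≈⟨ solve 4 (λ a s w k → (a :+ s) :+ (w :+ (w :+ k))
           := (w :+ a) :+ (w :+ (s :+ k))) refl (g zero) (∑ S g′) w (k · w) ⟩
    (w + g zero) + (w + (∑ S g′ + k · w))
      ≤⟨ +-mono-≤ (inj₂ (sym (near here))) (+-monoʳ-≤ w (∑-step T S (near ∘ there) (far ∘ suc))) ⟩
    f zero + (w + (∑ S f′ + ∣ S ∣ · w))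
      ≈⟨ solve 4 (λ a w s k → a :+ (w :+ (s :+ k))
           := (a :+ s) :+ (w :+ k)) refl (f zero) w (∑ S f′) (∣ S ∣ · w) ⟩
    (f zero + ∑ S f′) + (w + ∣ S ∣ · w)           ∎
    where
    open ≤-Reasoning
    f′ g′ : _ → Carrier
    f′ i = f (suc i)
    g′ i = g (suc i)
    k : ℕ
    k = ∣ T ∩ S ∣ ℕ.* 2
  ∑-step (outside ∷ T) (inside ∷ S) {f} {g} {w} near far = begin
    (g zero + ∑ S g′) + k · w                    ≈⟨ +-assoc _ _ _ ⟩
    g zero + (∑ S g′ + k · w)
      ≤⟨ +-mono-≤ (far zero) (∑-step T S (near ∘ there) (far ∘ suc)) ⟩
    (w + f zero) + (∑ S f′ + ∣ S ∣ · w)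
      ≈⟨ solve 4 (λ a w s k → (w :+ a) :+ (s :+ k)
           := (a :+ s) :+ (w :+ k)) refl (f zero) w (∑ S f′) (∣ S ∣ · w) ⟩
    (f zero + ∑ S f′) + (w + ∣ S ∣ · w)           ∎
    where
    open ≤-Reasoning
    f′ g′ : _ → Carrier
    f′ i = f (suc i)
    g′ i = g (suc i)
    k : ℕ
    k = ∣ T ∩ S ∣ ℕ.* 2

  module _ {n} (G : WeightedGraph n) (D : ShortestPathDistance G) where
    open WeightedGraph G
    open ShortestPathDistance D

    ∈N⁺ : ∀ {v u x} → d v x ≈ w v u + d u x → x ∈ N G D v u
    ∈N⁺ {x = x} eq = lookup⇒[]= x _ (≡.trans (lookup∘tabulate _ x) (dec-true (_ ≟ _) eq))

    ∈N⁻ : ∀ {v u x} → x ∈ N G D v u → d v x ≈ w v u + d u x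
    ∈N⁻ {x = x} x∈N = does⁻ (_ ≟ _) (≡.trans (≡.sym (lookup∘tabulate _ x)) ([]=⇒lookup x∈N))

    ∈E⁺ : ∀ {v u x} → Adj v u → x ∈ N G D v u → u ∈ E G D x v
    ∈E⁺ {v} {u} {x} v~u x∈N = lookup⇒[]= u _ (≡.trans (lookup∘tabulate _ u)
      (dec-true (adj? v u ×-dec x ∈? N G D v u) (v~u , x∈N)))

    ∈E⁻ : ∀ {v u x} → u ∈ E G D x v → x ∈ N G D v u
    ∈E⁻ {v} {u} {x} u∈E = proj₂ (does⁻ (adj? v u ×-dec x ∈? N G D v u)
      (≡.trans (≡.sym (lookup∘tabulate _ u)) ([]=⇒lookup u∈E)))

    d≈ℓ-w⁺ : ∀ {v u ℓ x} → x ∈ N G D v u → ℓ ≈ d v x → d u x ≈ ℓ - w v u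
    d≈ℓ-w⁺ {v} {u} {ℓ} {x} x∈N ℓ≈d = begin-equality
      d u x                       ≈⟨ y-x+x≈y (d u x) (w v u) ⟨
      (d u x - w v u) + w v u
        ≈⟨ solve 3 (λ a b c → (a :+ b) :+ c := (c :+ a) :+ b) refl (d u x) (- w v u) (w v u) ⟩
      (w v u + d u x) - w v u     ≈⟨ +-congʳ (trans ℓ≈d (∈N⁻ x∈N)) ⟨
      ℓ - w v u                   ∎
      where open ≤-Reasoning

    d≈ℓ-w⁻ : ∀ {v u ℓ x} → d u x ≈ ℓ - w v u → ℓ ≈ d v x → x ∈ N G D v u
    d≈ℓ-w⁻ {v} {u} {ℓ} {x} d≈ ℓ≈d = ∈N⁺ (begin-equality
      d v x                   ≈⟨ ℓ≈d ⟨
      ℓ                       ≈⟨ y-x+x≈y ℓ (w v u) ⟨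
      (ℓ - w v u) + w v u     ≈⟨ +-comm _ _ ⟩
      w v u + (ℓ - w v u)     ≈⟨ +-congˡ d≈ ⟨
      w v u + d u x           ∎)
      where open ≤-Reasoning

    d-step : ∀ {v u} → Adj v u → ∀ x → d u x ≤ w v u + d v x
    d-step {v} {u} v~u x = let p , dvx≈p = attained v x in begin
      d u x                ≤⟨ shortest (symmetric v~u ◅ p) ⟩
      w u v + length p     ≈⟨ +-cong (w-sym (symmetric v~u)) (sym dvx≈p) ⟩
      w v u + d v x        ∎
      where open ≤-Reasoning

    ∣N∩S∣≤Γ : ∀ {v u} S → Adj v u → ∣ N G D v u ∩ S ∣ ℕ.≤ Γ G D S v
    ∣N∩S∣≤Γ {v} {u} S v~u = All.lookup (xs≤max 0 _)
      (∈-map⁺ (λ u → ∣ N G D v u ∩ S ∣) (∈-filter⁺ (adj? v) (∈-allFin u) v~u))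

    -- At a vertex with least sum of distances to S, no direction holds more than
    -- half of S: the step towards it would decrease the sum.
    centroid : ∀ S {v u} → (∀ x → ∑ S (d v) ≤ ∑ S (d x)) → Adj v u →
               ∣ N G D v u ∩ S ∣ ℕ.* 2 ℕ.≤ ∣ S ∣
    centroid S {v} {u} least v~u = ·-cancelˡ-≤ (w-pos v~u) (+-cancelʳ-≤ (∑ S (d v)) (begin
      k · w v u + ∑ S (d v)      ≤⟨ +-monoʳ-≤ _ (least u) ⟩
      k · w v u + ∑ S (d u)      ≈⟨ +-comm _ _ ⟩
      ∑ S (d u) + k · w v u      ≤⟨ ∑-step (N G D v u) S ∈N⁻ (d-step v~u) ⟩
      ∑ S (d v) + ∣ S ∣ · w v u   ≈⟨ +-comm _ _ ⟩
      ∣ S ∣ · w v u + ∑ S (d v)   ∎))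
      where
      open ≤-Reasoning
      k : ℕ
      k = ∣ N G D v u ∩ S ∣ ℕ.* 2

    -- The minimum that the definition of a median refers to.
    minΓ : Subset n → ℕ
    minΓ S = min n (List.map (Γ G D S) (allFin n))

    2minΓ≤∣S∣ : Fin n → ∀ S → minΓ S ℕ.* 2 ℕ.≤ ∣ S ∣
    2minΓ≤∣S∣ x S with minimiser x (λ v → ∑ S (d v))
    ... | v , least = begin
      minΓ S ℕ.* 2                ≤⟨ ℕ.*-monoˡ-≤ 2 minΓ≤Γ ⟩
      Γ G D S v ℕ.* 2             ≤⟨ ℕ.*-monoˡ-≤ 2 Γ≤half ⟩
      ∣ S ∣ ℕ./ 2 ℕ.* 2            ≤⟨ m/n*n≤m ∣ S ∣ 2 ⟩
      ∣ S ∣                       ∎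
      where
      open ℕ.≤-Reasoning
      minΓ≤Γ : minΓ S ℕ.≤ Γ G D S v
      minΓ≤Γ = min≤v⁺ n _ (inj₂
        (Any.map (ℕ.≤-reflexive ∘ ≡.sym) (∈-map⁺ (Γ G D S) (∈-allFin v))))
      Γ≤half : Γ G D S v ℕ.≤ ∣ S ∣ ℕ./ 2
      Γ≤half = max≤v⁺ ℕ.z≤n (All.map⁺ (All.tabulate λ u∈ →
        halve (centroid S least (proj₂ (∈-filter⁻ (adj? v) {xs = allFin n} u∈)))))
        where
        halve : ∀ {k} → k ℕ.* 2 ℕ.≤ ∣ S ∣ → k ℕ.≤ ∣ S ∣ ℕ./ 2
        halve {k} 2k≤∣S∣ = begin
          k                  ≡⟨ m*n/n≡m k 2 ⟨
          k ℕ.* 2 ℕ./ 2      ≤⟨ /-monoˡ-≤ 2 2k≤∣S∣ ⟩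
          ∣ S ∣ ℕ./ 2         ∎

    -- Here h is one half.
    median-shrinks : Fin n → ∀ {ε h} → 0# ≤ ε → 0# ≤ h → (1# + 1#) * h ≈ 1# → ∀ S {v u} →
                     IsMedian G D ε S v → Adj v u →
                     fromℕ ∣ S ∩ N G D v u ∣ ≤ (1# + ε) * h * fromℕ ∣ S ∣
    median-shrinks x {ε} {h} 0≤ε 0≤h 2h≈1 S {v} {u} isMedian v~u = begin
      fromℕ ∣ S ∩ N G D v u ∣                 ≡⟨ ≡.cong (λ T → fromℕ ∣ T ∣) (∩-comm S _) ⟩
      fromℕ ∣ N G D v u ∩ S ∣                 ≤⟨ fromℕ-mono-≤ (∣N∩S∣≤Γ S v~u) ⟩
      fromℕ (Γ G D S v)                       ≤⟨ isMedian ⟩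
      (1# + ε) * μ                            ≈⟨ *-congˡ (trans (*-congʳ 2h≈1) (*-identityˡ μ)) ⟨
      (1# + ε) * ((1# + 1#) * h * μ)
        ≈⟨ solve 3 (λ e h m → e :* ((con 1 :+ con 1) :* h :* m)
             := e :* h :* (m :* (con 1 :+ (con 1 :+ con 0)))) refl (1# + ε) h μ ⟩
      (1# + ε) * h * (μ * fromℕ 2)            ≈⟨ *-congˡ (×1-homo-* (minΓ S) 2) ⟨
      (1# + ε) * h * fromℕ (minΓ S ℕ.* 2)
        ≤⟨ *-monoˡ-≤ (0≤x*y (0≤x+y (inj₁ 0<1) 0≤ε) 0≤h) (fromℕ-mono-≤ (2minΓ≤∣S∣ x S)) ⟩
      (1# + ε) * h * fromℕ ∣ S ∣               ∎
      where
      open ≤-Reasoning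
      μ : Carrier
      μ = fromℕ (minΓ S)

  -- The loss in searching a list

  -- `FirstHit P π δ₀ xs δ`: some element of xs satisfies P, and δ is at least δ₀
  -- plus π for each element in front of the first such one. Here π is the price
  -- of testing a wrong pair, and δ₀ the loss that is reserved for later.
  data FirstHit {A : Set a} (P : Pred A ℓ) (π δ₀ : Carrier) :
         List A → Carrier → Set (a ⊔ ℓ ⊔ c ⊔ ℓ₁ ⊔ ℓ₂) where
    hit  : ∀ {x xs δ} → P x → δ₀ ≤ δ → FirstHit P π δ₀ (x ∷ xs) δ
    miss : ∀ {x xs δ δ′} → ¬ P x → FirstHit P π δ₀ xs δ′ → π + δ′ ≤ δ →
           FirstHit P π δ₀ (x ∷ xs) δ

  module _ {P : Pred A ℓ} {π δ₀ : Carrier} (0≤π : 0# ≤ π) where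
    δ′≤π+δ′ : ∀ {δ′ δ} → π + δ′ ≤ δ → δ′ ≤ δ
    δ′≤π+δ′ {δ′} {δ} π+δ′≤δ = begin
      δ′     ≤⟨ x≤x+y δ′ 0≤π ⟩
      δ′ + π ≈⟨ +-comm δ′ π ⟩
      π + δ′ ≤⟨ π+δ′≤δ ⟩
      δ      ∎
      where open ≤-Reasoning

    firstHit-≤ : ∀ {xs δ} → FirstHit P π δ₀ xs δ → δ₀ ≤ δ
    firstHit-≤ (hit _ δ₀≤δ)       = δ₀≤δ
    firstHit-≤ (miss _ h π+δ′≤δ) = ≤-trans (firstHit-≤ h) (δ′≤π+δ′ π+δ′≤δ)

    firstHit-mono : ∀ {xs δ δ′} → δ ≤ δ′ → FirstHit P π δ₀ xs δ → FirstHit P π δ₀ xs δ′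
    firstHit-mono δ≤δ′ (hit px δ₀≤δ)  = hit px (≤-trans δ₀≤δ δ≤δ′)
    firstHit-mono δ≤δ′ (miss ¬px h ≤δ) = miss ¬px h (≤-trans ≤δ δ≤δ′)

    firstHit-filter : {Q : Pred A ℓ′} (Q? : Decidable Q) → (∀ {x} → P x → Q x) →
                      ∀ {xs δ} → FirstHit P π δ₀ xs δ → FirstHit P π δ₀ (filter Q? xs) δ
    firstHit-filter Q? P⇒Q {x ∷ _} (hit px δ₀≤δ) with Q? x
    ... | yes _  = hit px δ₀≤δ
    ... | no ¬qx = contradiction (P⇒Q px) ¬qx
    firstHit-filter Q? P⇒Q {x ∷ _} (miss ¬px h ≤δ) with Q? x
    ... | yes _ = miss ¬px (firstHit-filter Q? P⇒Q h) ≤δ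
    ... | no  _ = firstHit-mono (δ′≤π+δ′ ≤δ) (firstHit-filter Q? P⇒Q h)

    -- Removing repetitions keeps first occurrences, so the first hit survives and
    -- the elements in front of it can only become fewer.
    firstHit-deduplicate : {R : Rel A ℓ′} (R? : Binary.Decidable R) →
                           (∀ {x y} → R x y → P y → P x) →
                           ∀ {xs δ} → FirstHit P π δ₀ xs δ →
                           FirstHit P π δ₀ (deduplicate R? xs) δ
    firstHit-deduplicate R? resp (hit px δ₀≤δ) = hit px δ₀≤δ
    firstHit-deduplicate R? resp (miss ¬px h ≤δ) = miss ¬px
      (firstHit-filter (¬? ∘ R? _) (λ py r → ¬px (resp r py)) (firstHit-deduplicate R? resp h)) ≤δ

  firstHit⇒Any : ∀ {P : Pred A ℓ} {π δ₀ xs δ} → FirstHit P π δ₀ xs δ → Any P xs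
  firstHit⇒Any (hit px _)   = here px
  firstHit⇒Any (miss _ h _) = there (firstHit⇒Any h)

  -- Failure bounds for programs

  module Serving (p₁ p₂ : Carrier) (0≤p₁ : 0# ≤ p₁) (0≤p₂ : 0# ≤ p₂) (p₁+p₂≈1 : p₁ + p₂ ≈ 1#) where
    average : ∀ x → p₁ * x + p₂ * x ≈ x
    average x = begin-equality
      p₁ * x + p₂ * x ≈⟨ distribʳ x p₁ p₂ ⟨
      (p₁ + p₂) * x   ≈⟨ *-congʳ p₁+p₂≈1 ⟩
      1# * x          ≈⟨ *-identityˡ x ⟩
      x               ∎
      where open ≤-Reasoning

    0≤Pr : ∀ k E → 0# ≤ Pr p₁ p₂ k E
    0≤Pr ℕ.zero E with E []
    ... | true  = inj₁ 0<1
    ... | false = ≤-refl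
    0≤Pr (ℕ.suc k) E = 0≤x+y (0≤x*y 0≤p₁ (0≤Pr k _)) (0≤x*y 0≤p₂ (0≤Pr k _))

    Pr-sure : ∀ k {E} → (∀ ω → E ω ≡ true) → Pr p₁ p₂ k E ≈ 1#
    Pr-sure ℕ.zero {E} sure rewrite sure [] = refl
    Pr-sure (ℕ.suc k) sure = begin-equality
      p₁ * Pr p₁ p₂ k _ + p₂ * Pr p₁ p₂ k _
        ≈⟨ +-cong (*-congˡ (Pr-sure k λ ω → sure (first ∷ ω)))
                  (*-congˡ (Pr-sure k λ ω → sure (second ∷ ω))) ⟩
      p₁ * 1# + p₂ * 1#                     ≈⟨ average 1# ⟩
      1#                                    ∎
      where open ≤-Reasoning

    module Run {n} (G : WeightedGraph n) (D : ShortestPathDistance G) (t : Target → Fin n) where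
      open WeightedGraph G
      open ShortestPathDistance D

      -- `Bound Φ p m δ`: against every truthful oracle, the program p, run with
      -- a budget of m queries, leads to failure, in p or in what follows it, with
      -- probability at most δ. The postcondition Φ x m′ δ′ says what is known on
      -- return about the result x, the budget m′ that is left, and the failure
      -- probability δ′ that may still be incurred afterwards.
      -- A loss of at least 1 bounds any failure probability, hence `giveUp`, even
      -- when the budget is exhausted. In `query`, δ₁ and δ₂ are the losses when
      -- the query is served for the first and the second target. If it reveals the
      -- second target nothing can be lost, so there only 0 ≤ δ₂ is asked.
      data Bound {A : Set a} (Φ : A → ℕ → Carrier → Set ℓ) :
             Program G D A → ℕ → Carrier → Set (a ⊔ ℓ ⊔ c ⊔ ℓ₁ ⊔ ℓ₂) where
        giveUp : ∀ {p m δ} → 1# ≤ δ → Bound Φ p m δ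
        return : ∀ {x m δ} → Φ x m δ → Bound Φ (return x) m δ
        query  : ∀ {v f m δ} δ₁ δ₂ → 0# ≤ δ₂ → p₁ * δ₁ + p₂ * δ₂ ≤ δ →
                 (∀ {r} → Truthful G D t first v r → Bound Φ (f r) m δ₁) →
                 (∀ {u ℓ} → Truthful G D t second v (toward u ℓ) →
                  Bound Φ (f (toward u ℓ)) m δ₂) →
                 Bound Φ (query v f) (ℕ.suc m) δ

      map : {Φ : A → ℕ → Carrier → Set ℓ} {Ψ : A → ℕ → Carrier → Set ℓ′} →
            (∀ {x m δ} → Φ x m δ → Ψ x m δ) →
            ∀ {p m δ} → Bound Φ p m δ → Bound Ψ p m δ
      map φ (giveUp 1≤δ)                 = giveUp 1≤δ
      map φ (return x)                   = return (φ x)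
      map φ (query δ₁ δ₂ 0≤δ₂ δ≥ b₁ b₂) =
        query δ₁ δ₂ 0≤δ₂ δ≥ (λ τ → map φ (b₁ τ)) (λ τ → map φ (b₂ τ))

      bind : {f : A → Program G D B} {Ψ : B → ℕ → Carrier → Set ℓ} →
             ∀ {p m δ} → Bound (λ x → Bound Ψ (f x)) p m δ →
             Bound Ψ (_>>=_ G D p f) m δ
      bind (giveUp 1≤δ)                = giveUp 1≤δ
      bind (return b)                  = b
      bind (query δ₁ δ₂ 0≤δ₂ δ≥ b₁ b₂) =
        query δ₁ δ₂ 0≤δ₂ δ≥ (λ τ → bind (b₁ τ)) (λ τ → bind (b₂ τ))

      -- A loss π may be set aside before p runs and charged when p returns.
      shift : {Φ : A → ℕ → Carrier → Set ℓ} {π : Carrier} → 0# ≤ π →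
              ∀ {p m δ} → Bound (λ x m δ → Φ x m (π + δ)) p m δ → Bound Φ p m (π + δ)
      shift {π = π} 0≤π {δ = δ} (giveUp 1≤δ) = giveUp (begin
        1#     ≤⟨ 1≤δ ⟩
        δ      ≤⟨ x≤x+y δ 0≤π ⟩
        δ + π  ≈⟨ +-comm δ π ⟩
        π + δ  ∎)
        where open ≤-Reasoning
      shift 0≤π (return x) = return x
      shift {π = π} 0≤π {δ = δ} (query δ₁ δ₂ 0≤δ₂ δ≥ b₁ b₂) =
        query (π + δ₁) (π + δ₂) (0≤x+y 0≤π 0≤δ₂) (begin
          p₁ * (π + δ₁) + p₂ * (π + δ₂)
            ≈⟨ solve 5 (λ p q x y z → p :* (x :+ y) :+ q :* (x :+ z)
                 := (p :* x :+ q :* x) :+ (p :* y :+ q :* z)) refl p₁ p₂ π δ₁ δ₂ ⟩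
          (p₁ * π + p₂ * π) + (p₁ * δ₁ + p₂ * δ₂) ≤⟨ +-mono-≤ (inj₂ (average π)) δ≥ ⟩
          π + δ                                 ∎)
          (λ τ → shift 0≤π (b₁ τ)) (λ τ → shift 0≤π (b₂ τ))
        where open ≤-Reasoning

      moreBudget : {Φ : A → ℕ → Carrier → Set ℓ} →
                   (∀ {x m m′ δ} → m ℕ.≤ m′ → Φ x m δ → Φ x m′ δ) →
                   ∀ {p m m′ δ} → m ℕ.≤ m′ → Bound Φ p m δ → Bound Φ p m′ δ
      moreBudget mono m≤m′ (giveUp 1≤δ) = giveUp 1≤δ
      moreBudget mono m≤m′ (return x)   = return (mono m≤m′ x)
      moreBudget mono (ℕ.s≤s m≤m′) (query δ₁ δ₂ 0≤δ₂ δ≥ b₁ b₂) =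
        query δ₁ δ₂ 0≤δ₂ δ≥
          (λ τ → moreBudget mono m≤m′ (b₁ τ)) (λ τ → moreBudget mono m≤m′ (b₂ τ))

      -- The postcondition of the whole search: it returns the second target.
      Located : Maybe (Fin n) → ℕ → Carrier → Set (ℓ₁ ⊔ ℓ₂)
      Located r m δ = r ≡ just (t second) × 0# ≤ δ

      module _ (O : Oracle G D t) where
        open Oracle O
        sound : ∀ {p m δ} → Bound Located p m δ → ∀ h →
                1# ≤ δ + Pr p₁ p₂ m (detects G D O p h)
        sound {p} {m} {δ} (giveUp 1≤δ) h = ≤-trans 1≤δ (x≤x+y δ (0≤Pr m (detects G D O p h)))
        sound {m = m} {δ} (return (≡.refl , 0≤δ)) h = begin
          1#        ≤⟨ x≤x+y 1# 0≤δ ⟩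
          1# + δ    ≈⟨ +-comm 1# δ ⟩
          δ + 1#    ≈⟨ +-congˡ (Pr-sure m λ _ → dec-true (t second Fin.≟ t second) ≡.refl) ⟨
          δ + Pr p₁ p₂ m _ ∎
          where open ≤-Reasoning
        sound {query v f} {ℕ.suc m} {δ} (query δ₁ δ₂ 0≤δ₂ δ≥ b₁ b₂) h = begin
          1#                                              ≈⟨ average 1# ⟨
          p₁ * 1# + p₂ * 1#
            ≤⟨ +-mono-≤ (*-monoˡ-≤ 0≤p₁ served-first) (*-monoˡ-≤ 0≤p₂ served-second) ⟩
          p₁ * (δ₁ + P₁) + p₂ * (δ₂ + P₂)
            ≈⟨ solve 6 (λ p q x y z w → p :* (x :+ y) :+ q :* (z :+ w)
                 := (p :* x :+ q :* z) :+ (p :* y :+ q :* w)) refl p₁ p₂ δ₁ P₁ δ₂ P₂ ⟩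
          (p₁ * δ₁ + p₂ * δ₂) + (p₁ * P₁ + p₂ * P₂)       ≤⟨ +-monoˡ-≤ _ δ≥ ⟩
          δ + (p₁ * P₁ + p₂ * P₂)                         ∎
          where
          open ≤-Reasoning
          served : Target → Vec Target m → Bool
          served i ω = detects G D O (query v f) h (i ∷ ω)
          P₁ P₂ : Carrier
          P₁ = Pr p₁ p₂ m (served first)
          P₂ = Pr p₁ p₂ m (served second)
          served-first : 1# ≤ δ₁ + P₁
          served-first with answer h v first | truthful h v first
          ... | r@(found first) | τ = sound (b₁ τ) ((v , first , r) ∷ h)
          ... | r@(toward _ _) | τ = sound (b₁ τ) ((v , first , r) ∷ h)
          served-second : 1# ≤ δ₂ + P₂
          served-second with answer h v second | truthful h v second
          ... | r@(toward _ _) | τ = sound (b₂ τ) ((v , second , r) ∷ h)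
          ... | found second | _ = begin
            1#               ≤⟨ x≤x+y 1# 0≤δ₂ ⟩
            1# + δ₂          ≈⟨ +-comm 1# δ₂ ⟩
            δ₂ + 1#          ≈⟨ +-congˡ (Pr-sure m λ _ → ≡.refl) ⟨
            δ₂ + Pr p₁ p₂ m _ ∎

      -- Responses to repeated queries

      -- The number of times that each query is repeated.
      L : ℕ
      L = ⌈log₂ n ⌉

      -- The pair is a truthful answer at v for target i, adjacency aside. A pair
      -- can point to both targets, whichever of them it was served for.
      Points : Target → Fin n → Pair G D → Set ℓ₁
      Points i v (u , ℓ) = t i ∈ N G D v u × ℓ ≈ d v (t i)

      points? : ∀ i v x → Dec (Points i v x)
      points? i v (u , ℓ) = t i ∈? N G D v u ×-dec ℓ ≟ d v (t i)

      -- The pair is a truthful answer at v for one of the targets.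
      Valid : Fin n → Pair G D → Set ℓ₁
      Valid v x = Adj v (proj₁ x) × ∃ λ i → Points i v x

      responses-valid : ∀ k {v m δ} → 0# ≤ δ →
        Bound (λ q m′ δ′ → m′ ≡ m × δ′ ≡ δ × List.length q ℕ.≤ k × All (Valid v) q)
              (responses G D k v) (k ℕ.+ m) δ
      responses-valid ℕ.zero 0≤δ = return (≡.refl , ≡.refl , ℕ.z≤n , [])
      responses-valid (ℕ.suc k) {v} {m} {δ} 0≤δ = query δ δ 0≤δ (inj₂ (average δ))
        (λ { (found _) → bind (map (λ (m≡ , δ≡ , len , valid) →
               return (m≡ , δ≡ , ℕ.m≤n⇒m≤1+n len , valid)) (responses-valid k 0≤δ))
           ; (toward v~u t∈N ℓ≈d) → pointed v~u (first , t∈N , ℓ≈d) })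
        (λ { (toward v~u t∈N ℓ≈d) → pointed v~u (second , t∈N , ℓ≈d) })
        where
        pointed : ∀ {x} → Adj v (proj₁ x) → (∃ λ i → Points i v x) → Bound _ _ (k ℕ.+ m) δ
        pointed v~u pts = bind (map (λ (m≡ , δ≡ , len , valid) →
          return (m≡ , δ≡ , ℕ.s≤s len , (v~u , pts) ∷ valid)) (responses-valid k 0≤δ))

      -- The fixed-point equation says that r = p₁/p₂. For a geometric number of
      -- queries served for the first target before one is served for the second,
      -- it is the recursion for the mean.
      module _ {r} (0≤r : 0# ≤ r) (r-fix : p₁ + p₁ * r ≈ r)
               {π δ₀} (0≤π : 0# ≤ π) (0≤δ₀ : 0# ≤ δ₀) where
        -- The budget left is m, and the responses contain a pair that points to the
        -- second target, late hits being charged to the loss.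
        Hit : ℕ → ℕ → Fin n → List (Pair G D) → ℕ → Carrier → Set (c ⊔ ℓ₁ ⊔ ℓ₂)
        Hit k m v q m′ δ = m′ ≡ m × List.length q ℕ.≤ k × All (Valid v) q ×
                           FirstHit (Points second v) π δ₀ q δ

        -- Without a query served for the second target, of probability p₁ ^ k, all
        -- is given up. Otherwise the pairs in front of the first hit cost at most
        -- r * π on average.
        responses-hit : ∀ k {v m δ} → p₁ ^ k + r * π + δ₀ ≤ δ →
                        Bound (Hit k m v) (responses G D k v) (k ℕ.+ m) δ
        responses-hit ℕ.zero δ≥ = giveUp (≤-trans
          (≤-trans (x≤x+y 1# (0≤x*y 0≤r 0≤π)) (x≤x+y _ 0≤δ₀)) δ≥)
        -- When the query is served for the first target, π is reserved in case the
        -- response is a miss.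
        responses-hit (ℕ.suc k) {v} {m} {δ} δ≥ = query (π + rest) δ₀ 0≤δ₀ (begin
            p₁ * (π + (p₁ ^ k + r * π + δ₀)) + p₂ * δ₀
              ≈⟨ solve 6 (λ p q x y b z → p :* (x :+ (y :+ b :* x :+ z)) :+ q :* z
                           := p :* y :+ (p :+ p :* b) :* x :+ (p :* z :+ q :* z))
                   refl p₁ p₂ π (p₁ ^ k) r δ₀ ⟩
            p₁ * p₁ ^ k + (p₁ + p₁ * r) * π + (p₁ * δ₀ + p₂ * δ₀)
              ≈⟨ +-cong (+-congˡ (*-congʳ r-fix)) (average δ₀) ⟩
            p₁ * p₁ ^ k + r * π + δ₀
              ≤⟨ δ≥ ⟩
            δ ∎)
          (λ { (found _) → bind (map (λ (m≡ , len , valid , h) →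
                 return (m≡ , ℕ.m≤n⇒m≤1+n len , valid , h))
                 (responses-hit k rest≤π+rest))
             ; (toward v~u t∈N ℓ≈d) → served-first v~u (t∈N , ℓ≈d) })
          (λ { (toward v~u t∈N ℓ≈d) → served-hit 0≤δ₀ ≤-refl v~u second (t∈N , ℓ≈d) (t∈N , ℓ≈d) })
          where
          open ≤-Reasoning
          rest : Carrier
          rest = p₁ ^ k + r * π + δ₀
          0≤p₁ᵏ+rπ : 0# ≤ p₁ ^ k + r * π
          0≤p₁ᵏ+rπ = 0≤x+y (0≤x^k k 0≤p₁) (0≤x*y 0≤r 0≤π)
          rest≤π+rest : rest ≤ π + rest
          rest≤π+rest = ≤-trans (x≤x+y rest 0≤π) (inj₂ (+-comm rest π))
          δ₀≤π+rest : δ₀ ≤ π + rest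
          δ₀≤π+rest = ≤-trans (≤-trans (x≤x+y δ₀ 0≤p₁ᵏ+rπ) (inj₂ (+-comm _ _))) rest≤π+rest
          then : Pair G D → Program G D (List (Pair G D))
          then x = _>>=_ G D (responses G D k v) λ q → return (x ∷ q)
          served-hit : ∀ {x δ′} → 0# ≤ δ′ → δ₀ ≤ δ′ → Adj v (proj₁ x) → ∀ i → Points i v x →
                       Points second v x →
                       Bound (Hit (ℕ.suc k) m v) (then x) (k ℕ.+ m) δ′
          served-hit 0≤δ′ δ₀≤δ′ v~u i pts hits = bind (map
            (λ { (m≡ , ≡.refl , len , valid) →
               return (m≡ , ℕ.s≤s len , (v~u , i , pts) ∷ valid , hit hits δ₀≤δ′) })
            (responses-valid k 0≤δ′))
          served-first : ∀ {x} → Adj v (proj₁ x) → Points first v x →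
                         Bound (Hit (ℕ.suc k) m v) (then x) (k ℕ.+ m) (π + rest)
          served-first {x} v~u pts with points? second v x
          ... | yes hits = served-hit (≤-trans 0≤δ₀ δ₀≤π+rest) δ₀≤π+rest v~u first pts hits
          ... | no ¬hits = bind (shift 0≤π (map (λ (m≡ , len , valid , h) →
                 return (m≡ , ℕ.s≤s len , (v~u , first , pts) ∷ valid , miss ¬hits h ≤-refl))
                 (responses-hit k ≤-refl)))

        Q-hit : ∀ {v m δ} → p₁ ^ L + r * π + δ₀ ≤ δ → Bound (Hit L m v) (Q G D v) (L ℕ.+ m) δ
        Q-hit {v} δ≥ = bind (map (λ {q} (m≡ , len , valid , h) → return
          ( m≡ , ℕ.≤-trans (List.length-deduplicate eq? q) len , deduplicate⁺ eq? valid
          , firstHit-deduplicate 0≤π eq? resp h))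
          (responses-hit L δ≥))
          where
          eq? = ×-decidable Fin._≟_ _≟_
          resp : ∀ {x y} → proj₁ x ≡ proj₁ y × proj₂ x ≈ proj₂ y →
                 Points second v y → Points second v x
          resp (≡.refl , ℓ≈ℓ′) (t∈N , ℓ′≈d) = t∈N , trans ℓ≈ℓ′ ℓ′≈d

      Q-valid : ∀ {v m δ} → 0# ≤ δ →
        Bound (λ q m′ δ′ → m′ ≡ m × δ′ ≡ δ × All (Valid v) q) (Q G D v) (L ℕ.+ m) δ
      Q-valid 0≤δ = bind (map (λ (m≡ , δ≡ , _ , valid) →
        return (m≡ , δ≡ , deduplicate⁺ (×-decidable Fin._≟_ _≟_) valid)) (responses-valid L 0≤δ))

      -- The search algorithm

      module WithMedian (median : Subset n → Fin n) where
        open Algorithm G D (t first) median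

        -- What the test of the first pair requires of a response at its vertex.
        Passes : Fin n → Pair G D → Pair G D → Set ℓ₁
        Passes v (u , ℓ) (_ , ℓ′) = ℓ′ ≈ ℓ - w v u

        passes? : ∀ v x y → Dec (Passes v x y)
        passes? v (u , ℓ) (_ , ℓ′) = ℓ′ ≟ ℓ - w v u

        -- If the pair points to both targets, then both distances decrease by the
        -- weight of the edge, so every truthful response agrees.
        test-passes : ∀ {v x m δ} → Points first v x → Points second v x → 0# ≤ δ →
                      Bound (λ b m′ δ′ → b ≡ true × m′ ≡ m × δ′ ≡ δ) (test v x) (L ℕ.+ m) δ
        test-passes {v} {x} pts₁ pts₂ 0≤δ = bind (map
          (λ {q} (m≡ , δ≡ , valid) → return
            (dec-true (all? (passes? v x) q) (All.map passes valid) , m≡ , δ≡))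
          (Q-valid 0≤δ))
          where
          passes : ∀ {y} → Valid (proj₁ x) y → Passes v x y
          passes (_ , first  , _ , ℓ′≈d) = trans ℓ′≈d (d≈ℓ-w⁺ G D (proj₁ pts₁) (proj₂ pts₁))
          passes (_ , second , _ , ℓ′≈d) = trans ℓ′≈d (d≈ℓ-w⁺ G D (proj₁ pts₂) (proj₂ pts₂))

        module _ {r} (0≤r : 0# ≤ r) (r-fix : p₁ + p₁ * r ≈ r) where
          -- The probability that none of the L repetitions of a query is served for
          -- the second target.
          π : Carrier
          π = p₁ ^ L

          0≤π : 0# ≤ π
          0≤π = 0≤x^k L 0≤p₁

          -- A response for the second target contradicts a pair that reports the
          -- distance of that target but not a direction towards it.
          test-fails : ∀ {v u ℓ m δ₀ δ} → ℓ ≈ d v (t second) → t second ∉ N G D v u →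
                       0# ≤ δ₀ → π + δ₀ ≤ δ →
                       Bound (λ b m′ δ′ → b ≡ false × m′ ≡ m × δ₀ ≤ δ′) (test v (u , ℓ)) (L ℕ.+ m) δ
          test-fails {v} {u} {ℓ} {m} {δ₀} {δ} ℓ≈d t∉N 0≤δ₀ δ≥ = bind (map
            (λ {q} (m≡ , _ , _ , h) → return
              ( dec-false (all? (passes? v (u , ℓ)) q) (fails (firstHit⇒Any h))
              , m≡ , firstHit-≤ ≤-refl h))
            -- It does not matter how late such a response comes, so misses are free.
            (Q-hit 0≤r r-fix {π = 0#} ≤-refl 0≤δ₀ (begin
              π + r * 0# + δ₀   ≈⟨ +-congʳ (trans (+-congˡ (zeroʳ r)) (+-identityʳ π)) ⟩
              π + δ₀            ≤⟨ δ≥ ⟩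
              δ                 ∎)))
            where
            open ≤-Reasoning
            fails : ∀ {q} → Any (Points second u) q → ¬ All (Passes v (u , ℓ)) q
            fails (here (_ , ℓ′≈d)) (ℓ′≈ ∷ _)  = t∉N (d≈ℓ-w⁻ G D (trans (sym ℓ′≈d) ℓ′≈) ℓ≈d)
            fails (there any)       (_ ∷ all) = fails any all

          -- The postcondition of an iteration that queries v: S is cut down to a
          -- direction of the second target, with budget m and loss δ₀ to spare.
          Outcome : ℕ → Carrier → Subset n → Fin n → Subset n → ℕ → Carrier → Set (ℓ₁ ⊔ ℓ₂)
          Outcome m δ₀ S v S′ m′ δ =
            (∃ λ u → Adj v u × t second ∈ N G D v u × S′ ≡ S ∩ N G D v u) × m ℕ.≤ m′ × δ₀ ≤ δ

          outcome-mono : ∀ {m δ₀ S v S′ m′ m″ δ} → m′ ℕ.≤ m″ →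
                         Outcome m δ₀ S v S′ m′ δ → Outcome m δ₀ S v S′ m″ δ
          outcome-mono m′≤m″ (cut , m≤m′ , δ₀≤δ) = cut , ℕ.≤-trans m≤m′ m′≤m″ , δ₀≤δ

          -- The loss of `FirstHit` is what testing the pairs in order costs, provided
          -- that they all look like answers for the first target.
          testEach-outcome : ∀ {S v m M δ₀} q {δ} → 0# ≤ δ₀ →
            d v (t first) ≈ d v (t second) →
            All (λ x → Adj v (proj₁ x) × Points first v x) q →
            FirstHit (Points second v) π δ₀ q δ →
            List.length q ℕ.* L ℕ.+ m ℕ.≤ M →
            Bound (Outcome m δ₀ S v) (testEach S v q) M δ
          testEach-outcome {S} {v} {m} {M} {δ₀} ((u , ℓ) ∷ q) {δ}
                           0≤δ₀ d≈d ((v~u , pts₁) ∷ all) h len =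
            moreBudget outcome-mono
              (ℕ.≤-trans (ℕ.≤-reflexive (≡.sym (ℕ.+-assoc L (List.length q ℕ.* L) m))) len) (go h)
            where
            M′ : ℕ
            M′ = List.length q ℕ.* L ℕ.+ m
            go : FirstHit (Points second v) π δ₀ ((u , ℓ) ∷ q) δ →
                 Bound (Outcome m δ₀ S v) (testEach S v ((u , ℓ) ∷ q)) (L ℕ.+ M′) δ
            go (hit pts₂@(t∈N , _) δ₀≤δ) = bind (map
              (λ { (≡.refl , ≡.refl , ≡.refl) →
                   return ((u , v~u , t∈N , ≡.refl) , ℕ.m≤n+m m (List.length q ℕ.* L) , δ₀≤δ) })
              (test-passes pts₁ pts₂ (≤-trans 0≤δ₀ δ₀≤δ)))
            go (miss {δ′ = δ′} ¬pts₂ h′ π+δ′≤δ) = bind (map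
              (λ { (≡.refl , ≡.refl , δ′≤) →
                   testEach-outcome q 0≤δ₀ d≈d all (firstHit-mono 0≤π δ′≤ h′) ℕ.≤-refl })
              (test-fails ℓ≈d (λ t∈N → ¬pts₂ (t∈N , ℓ≈d))
                (≤-trans 0≤δ₀ (firstHit-≤ 0≤π h′)) π+δ′≤δ))
              where
              ℓ≈d : ℓ ≈ d v (t second)
              ℓ≈d = trans (proj₂ pts₁) d≈d

          -- The pair is inconsistent with the first target.
          Telling : Fin n → Pair G D → Set ℓ₁
          Telling v (u , ℓ) = u ∉ E G D (t first) v ⊎ ¬ (ℓ ≈ d v (t first))

          iteration-outcome : ∀ {S m δ₀ δ} → 0# ≤ δ₀ → π + r * π + δ₀ ≤ δ →
            Bound (Outcome m δ₀ S (median S)) (iteration S) (L ℕ.+ (L ℕ.* L ℕ.+ m)) δ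
          iteration-outcome {S} {m} {δ₀} 0≤δ₀ δ≥ =
            bind (map after (Q-hit 0≤r r-fix 0≤π 0≤δ₀ δ≥))
            where
            v : Fin n
            v = median S
            telling? : Decidable (Telling v)
            telling? (u , ℓ) = ¬? (u ∈? E G D (t first) v) ⊎-dec ¬? (ℓ ≟ d v (t first))
            continue : List (Pair G D) → Maybe (Pair G D) → Program G D (Subset n)
            continue q = maybe (λ (u , _) → return (S ∩ N G D v u)) (testEach S v q)
            after : ∀ {q m′ δ} → Hit 0≤r r-fix 0≤π 0≤δ₀ L (L ℕ.* L ℕ.+ m) v q m′ δ →
                    Bound (Outcome m δ₀ S v) (continue q (find telling? q)) m′ δ
            after {q} {δ = δ} (≡.refl , len , valid , h) = find-elim telling?
              (λ y → Bound (Outcome m δ₀ S v) (continue q y) (L ℕ.* L ℕ.+ m) δ) q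
              (λ x∈q telling → telling-pair (All.lookup valid x∈q) telling)
              (λ none → testEach-outcome q 0≤δ₀ (equidistant (firstHit⇒Any h) none)
                (All.zipWith (λ ((v~u , _) , ¬tell) → v~u , silent ¬tell) (valid , none)) h
                (ℕ.+-monoˡ-≤ m (ℕ.*-monoˡ-≤ L len)))
              where
              telling-pair : ∀ {x} → Valid v x → Telling v x →
                Bound (Outcome m δ₀ S v) (return (S ∩ N G D v (proj₁ x))) (L ℕ.* L ℕ.+ m) δ
              telling-pair (v~u , first  , t∈N , _) (inj₁ u∉E) = contradiction (∈E⁺ G D v~u t∈N) u∉E
              telling-pair (v~u , first  , _ , ℓ≈d) (inj₂ ℓ≉d) = contradiction ℓ≈d ℓ≉d
              telling-pair (v~u , second , t∈N , _) _ =
                return ((_ , v~u , t∈N , ≡.refl) , ℕ.m≤n+m m (L ℕ.* L) , firstHit-≤ 0≤π h)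
              silent : ∀ {x} → ¬ Telling v x → Points first v x
              silent {u , ℓ} ¬tell =
                ∈E⁻ G D (decidable-stable (u ∈? E G D (t first) v) (¬tell ∘ inj₁)) ,
                decidable-stable (ℓ ≟ d v (t first)) (¬tell ∘ inj₂)
              equidistant : ∀ {q} → Any (Points second v) q → All (¬_ ∘ Telling v) q →
                            d v (t first) ≈ d v (t second)
              equidistant (here (_ , ℓ≈d)) (¬tell ∷ _) = trans (sym (proj₂ (silent ¬tell))) ℓ≈d
              equidistant (there any)      (_ ∷ none)  = equidistant any none

          -- In terms of the number j of further iterations that are paid for: j
          -- shrinkings by ρ must suffice to make S a singleton.
          while-locates : ∀ {ρ} → 0# ≤ ρ →
            (∀ S {u} → Adj (median S) u → fromℕ ∣ S ∩ N G D (median S) u ∣ ≤ ρ * fromℕ ∣ S ∣) →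
            ∀ j {k S M δ} → j ℕ.≤ k → t second ∈ S → ρ ^ j * fromℕ ∣ S ∣ < 1# + 1# →
            j ℕ.* (L ℕ.+ L ℕ.* L) ℕ.≤ M → j · (π + r * π) ≤ δ →
            Bound Located (while k S) M δ
          while-locates {ρ} 0≤ρ shrinks = go
            where
            open ≤-Reasoning
            0≤τ : 0# ≤ π + r * π
            0≤τ = 0≤x+y 0≤π (0≤x*y 0≤r 0≤π)
            go : ∀ j {k S M δ} → j ℕ.≤ k → t second ∈ S → ρ ^ j * fromℕ ∣ S ∣ < 1# + 1# →
                 j ℕ.* (L ℕ.+ L ℕ.* L) ℕ.≤ M → j · (π + r * π) ≤ δ →
                 Bound Located (while k S) M δ
            go j {S = S} j≤k t∈S small budget loss with ∣ S ∣ ℕ.≤? 1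
            ... | yes ∣S∣≤1 =
              return (≡.cong unique (singleton-filter t∈S ∣S∣≤1) , ≤-trans (0≤k·x j 0≤τ) loss)
            go ℕ.zero {S = S} _ _ small _ _ | no ∣S∣≰1 = contradiction (begin
              1# + 1#             ≈⟨ +-congˡ (+-identityʳ 1#) ⟨
              fromℕ 2             ≤⟨ fromℕ-mono-≤ (ℕ.≰⇒> ∣S∣≰1) ⟩
              fromℕ ∣ S ∣         ≈⟨ *-identityˡ _ ⟨
              1# * fromℕ ∣ S ∣    ∎) (<⇒≱ small)
            go (ℕ.suc j) {ℕ.suc k} {S} (ℕ.s≤s j≤k) t∈S small budget loss | no _ = bind (map
              (λ { ((u , v~u , t∈N , ≡.refl) , budget′ , loss′) →
                go j j≤k (x∈p∩q⁺ (t∈S , t∈N)) (begin-strict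
                  ρ ^ j * fromℕ ∣ S ∩ N G D (median S) u ∣
                    ≤⟨ *-monoˡ-≤ (0≤x^k j 0≤ρ) (shrinks S v~u) ⟩
                  ρ ^ j * (ρ * fromℕ ∣ S ∣)
                    ≈⟨ solve 3 (λ a b c → a :* (b :* c) := b :* a :* c)
                         refl (ρ ^ j) ρ (fromℕ ∣ S ∣) ⟩
                  ρ * ρ ^ j * fromℕ ∣ S ∣
                    <⟨ small ⟩
                  1# + 1# ∎) budget′ loss′ })
              (moreBudget outcome-mono
                (ℕ.≤-trans (ℕ.≤-reflexive (≡.sym (ℕ.+-assoc L (L ℕ.* L) _))) budget)
                (iteration-outcome (0≤k·x j 0≤τ) loss)))

-- The constants, and the theorem

theorem8 :
    ∀ {c ℓ₁ ℓ₂} (K : ArchimedeanOrderedField c ℓ₁ ℓ₂) →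
    let open ArchimedeanOrderedField K
        open Search K in
    (p₁ p₂ ε : Carrier) →
    p₂ < p₁ → p₂ ≈ 1# - p₁ → 0# < p₂ →
    0# ≤ ε → ε < 1# →
    Σ[ C ∈ ℕ ] Σ[ C′ ∈ Carrier ]
      (∀ {n} (G : WeightedGraph n) (D : ShortestPathDistance G)
         (t : Target → Fin n) (O : Oracle G D t)
         (median : Subset n → Fin n) → (∀ S → IsMedian G D ε S (median S)) →
       1# - C′ * (fromℕ ⌈log₂ n ⌉ * p₁ ^ ⌈log₂ n ⌉)
         ≤ Pr p₁ p₂ (C ℕ.* ⌈log₂ n ⌉ ℕ.^ 3) (𝒟-detects G D O median))
theorem8 K p₁ p₂ ε p₂<p₁ p₂≈1-p₁ 0<p₂ 0≤ε ε<1 =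
  2 ℕ.* κ , fromℕ κ * (1# + r) , λ {n} G D t O median isMedian →
    let open Run G D t
        open WithMedian median
        j = κ ℕ.* L
        loss = fromℕ κ * (1# + r) * (fromℕ L * p₁ ^ L)
        located = while-locates 0≤r r-fix 0≤ρ
          (λ S → median-shrinks G D (t first) 0≤ε (inj₁ 0<h) 2h≈1 S (isMedian S))
          j (fuel L) ∈⊤ (small L (ℕ.≤-trans (ℕ.≤-reflexive (∣⊤∣≡n n)) (n≤2^⌈log₂n⌉ n)))
          (budget L) (≤-reflexive (total L (p₁ ^ L)))
    in begin
      1# - loss                     ≤⟨ +-monoˡ-≤ (- loss) (sound O located []) ⟩
      (loss + _) - loss
        ≈⟨ solve 3 (λ x y z → (x :+ y) :+ z := y :+ (x :+ z)) refl loss _ (- loss) ⟩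
      _ + (loss - loss)             ≈⟨ +-congˡ (-‿inverseʳ loss) ⟩
      _ + 0#                        ≈⟨ +-identityʳ _ ⟩
      Pr p₁ p₂ (2 ℕ.* κ ℕ.* L ℕ.^ 3) (𝒟-detects G D O median) ∎
  where
  open ArchimedeanOrderedField K hiding (zero)
  open Search K
  open Proof K
  open SemiringSolver commutativeSemiring using (solve; _:=_; _:+_; _:*_; con)
  open ≤-Reasoning
  open +-*-Solver using ()
    renaming (solve to ℕ-solve; _:*_ to _:*′_; _:+_ to _:+′_; _:=_ to _:=′_; con to con′)

  ≤-reflexive : ∀ {x y} → x ≈ y → x ≤ y
  ≤-reflexive = inj₂

  0<p₁ : 0# < p₁
  0<p₁ = <-trans 0<p₂ p₂<p₁
  p₁+p₂≈1 : p₁ + p₂ ≈ 1#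
  p₁+p₂≈1 = trans (+-congˡ p₂≈1-p₁) (trans (+-comm _ _) (y-x+x≈y 1# p₁))

  open Serving p₁ p₂ (inj₁ 0<p₁) (inj₁ 0<p₂) p₁+p₂≈1 using (module Run)

  -- r = p₁/p₂.
  r : Carrier
  r = p₁ * proj₁ (inverse (0<x⇒x≉0 0<p₂))
  0≤r : 0# ≤ r
  0≤r = inj₁ (*-pos 0<p₁ (0<inverse 0<p₂ (proj₂ (inverse (0<x⇒x≉0 0<p₂)))))
  p₂r≈p₁ : p₂ * r ≈ p₁
  p₂r≈p₁ with inverse (0<x⇒x≉0 0<p₂)
  ... | y , p₂y≈1 = begin-equality
    p₂ * (p₁ * y) ≈⟨ solve 3 (λ p q y → q :* (p :* y) := p :* (q :* y)) refl p₁ p₂ y ⟩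
    p₁ * (p₂ * y) ≈⟨ *-congˡ p₂y≈1 ⟩
    p₁ * 1#       ≈⟨ *-identityʳ p₁ ⟩
    p₁            ∎
  r-fix : p₁ + p₁ * r ≈ r
  r-fix = begin-equality
    p₁ + p₁ * r       ≈⟨ +-congʳ p₂r≈p₁ ⟨
    p₂ * r + p₁ * r   ≈⟨ solve 3 (λ p q b → q :* b :+ p :* b := (p :+ q) :* b) refl p₁ p₂ r ⟩
    (p₁ + p₂) * r     ≈⟨ *-congʳ p₁+p₂≈1 ⟩
    1# * r            ≈⟨ *-identityˡ r ⟩
    r                 ∎

  -- One half.
  h : Carrier
  h = proj₁ (inverse (0<x⇒x≉0 0<2))
  2h≈1 : (1# + 1#) * h ≈ 1#
  2h≈1 = proj₂ (inverse (0<x⇒x≉0 0<2))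
  0<h : 0# < h
  0<h = 0<inverse 0<2 2h≈1

  -- The factor by which an iteration shrinks S.
  ρ : Carrier
  ρ = (1# + ε) * h
  0<ρ : 0# < ρ
  0<ρ = begin-strict
    0#             <⟨ 0<h ⟩
    h              ≈⟨ *-identityˡ h ⟨
    1# * h         ≤⟨ *-monoʳ-≤ (inj₁ 0<h) (x≤x+y 1# 0≤ε) ⟩
    (1# + ε) * h   ∎
  0≤ρ : 0# ≤ ρ
  0≤ρ = inj₁ 0<ρ
  ρ<1 : ρ < 1#
  ρ<1 = begin-strict
    (1# + ε) * h   ≈⟨ solve 2 (λ e h → (con 1 :+ e) :* h := h :* (e :+ con 1)) refl ε h ⟩
    h * (ε + 1#)   <⟨ *-monoˡ-< h 0<h (+-monoˡ-< 1# ε<1) ⟩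
    h * (1# + 1#)  ≈⟨ *-comm _ _ ⟩
    (1# + 1#) * h  ≈⟨ 2h≈1 ⟩
    1#             ∎

  -- The number of iterations that halve S, so that κ * L iterations suffice.
  κ : ℕ
  κ = proj₁ (∃-halving 0<ρ ρ<1)

  small : ∀ L {m} → m ℕ.≤ 2 ℕ.^ L → ρ ^ (κ ℕ.* L) * fromℕ m < 1# + 1#
  small L {m} m≤2^L = begin-strict
    ρ ^ (κ ℕ.* L) * fromℕ m           ≤⟨ *-monoˡ-≤ (0≤x^k (κ ℕ.* L) 0≤ρ) (fromℕ-mono-≤ m≤2^L) ⟩
    ρ ^ (κ ℕ.* L) * fromℕ (2 ℕ.^ L)   ≈⟨ *-congʳ (^-assocʳ ρ κ L) ⟨
    (ρ ^ κ) ^ L * fromℕ (2 ℕ.^ L)     ≤⟨ a^k*2^k≤1 L (0≤x^k κ 0≤ρ) (proj₂ (∃-halving 0<ρ ρ<1)) ⟩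
    1#                                ≈⟨ +-identityˡ 1# ⟨
    0# + 1#                           <⟨ +-monoˡ-< 1# 0<1 ⟩
    1# + 1#                           ∎

  -- The losses of κ * L iterations add up to the bound claimed.
  total : ∀ L π → (κ ℕ.* L) · (π + r * π) ≈ fromℕ κ * (1# + r) * (fromℕ L * π)
  total L π = begin-equality
    (κ ℕ.* L) · (π + r * π)                   ≈⟨ ×-congʳ (κ ℕ.* L) (*-identityˡ _) ⟨
    (κ ℕ.* L) · (1# * (π + r * π))            ≈⟨ ×-assoc-* (κ ℕ.* L) 1# _ ⟨
    fromℕ (κ ℕ.* L) * (π + r * π)             ≈⟨ *-congʳ (×1-homo-* κ L) ⟩
    fromℕ κ * fromℕ L * (π + r * π)
      ≈⟨ solve 4 (λ a l p b → a :* l :* (p :+ b :* p)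
           := a :* (con 1 :+ b) :* (l :* p)) refl (fromℕ κ) (fromℕ L) π r ⟩
    fromℕ κ * (1# + r) * (fromℕ L * π)        ∎

  -- An iteration asks at most L + L * L queries, and L is 0 or at most L * L.
  budget : ∀ L → κ ℕ.* L ℕ.* (L ℕ.+ L ℕ.* L) ℕ.≤ 2 ℕ.* κ ℕ.* L ℕ.^ 3
  budget ℕ.zero      = ℕ.≤-reflexive (≡.trans (ℕ.*-zeroʳ (κ ℕ.* 0)) (≡.sym (ℕ.*-zeroʳ (2 ℕ.* κ))))
  budget L@(ℕ.suc _) = ℕ.≤-trans (ℕ.*-monoʳ-≤ (κ ℕ.* L) (ℕ.+-monoˡ-≤ (L ℕ.* L) (ℕ.m≤m*n L L)))
    (ℕ.≤-reflexive (ℕ-solve 2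
      (λ a l → a :*′ l :*′ (l :*′ l :+′ l :*′ l)
            :=′ con′ 2 :*′ a :*′ (l :*′ (l :*′ (l :*′ con′ 1)))) ≡.refl κ L))

  -- The number of iterations is also bounded by the number of queries allowed.
  fuel : ∀ L → κ ℕ.* L ℕ.≤ 2 ℕ.* κ ℕ.* L ℕ.^ 3
  fuel ℕ.zero      = ℕ.≤-trans (ℕ.≤-reflexive (ℕ.*-zeroʳ κ)) ℕ.z≤n
  fuel L@(ℕ.suc _) = ℕ.≤-trans (ℕ.m≤m*n (κ ℕ.* L) (L ℕ.+ L ℕ.* L)) (budget L)
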